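{- Let $n$ be a positive integer and let $a,b\in\mathbb{Z}_n^{*}$. If the cyclic subgroup $\langle b\rangle$ of $\mathbb{Z}_n^{*}$ is a subgroup of $\langle a\rangle$, then $\mathbb{I}_n(a)\subseteq\mathbb{I}_n(b)$.
   Context: $\mathbb{Z}_2^{n}$ denotes the group $\{+1,-1\}^n$ of binary sequences $Y=(y_0,\dots,y_{n-1})$ under componentwise multiplication, with indices read modulo $n$. $\mathbb{Z}_n^{*}$ is the group of units modulo $n$. For $a\in\mathbb{Z}_n^{*}$, the decimation $\delta_a$ acts on $\mathbb{Z}_2^{n}$ by $(\delta_a Y)_i=y_{ai \bmod n}$. Define $\mathbb{I}_n(a)=\{Y\in\mathbb{Z}_2^{n}:\delta_a Y=Y\}$. -}

module Defs where

open import Algebra.Bundles using (Monoid; Group; AbelianGroup)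
open import Algebra.Construct.Pointwise using () renaming (abelianGroup to pointwiseAbelianGroup)
open import Algebra.Definitions using (Invertible)
import Algebra.Definitions.RawMonoid as RawMonoidDefinitions
open import Data.Fin.Base using (Fin; toℕ)
open import Data.Fin.Properties using (toℕ<n; toℕ-fromℕ<; toℕ-injective)
open import Data.Integer.Base using (ℤ; +_; -[1+_])
open import Data.Nat.Base using (ℕ; suc; NonZero; _*_; _%_)
open import Data.Nat.DivMod using (_mod_; m%n<n; m%n%n≡m%n; m<n⇒m%n≡m; %-distribˡ-*)
open import Data.Nat.Properties using (*-comm; *-assoc; *-identityˡ)
open import Data.Product.Base using (∃-syntax; _,_; proj₁; proj₂)
import Data.Sign.Properties as Sign
open import Level using (Level; 0ℓ; _⊔_)
open import Relation.Binary.PropositionalEquality using (_≡_; sym; trans; cong; cong₂; isEquivalence; module ≡-Reasoning)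
open import Relation.Unary using (Pred)

private
  variable
    c ℓ : Level

module _ (M : Monoid c ℓ) where
  private
    module M = Monoid M
    open M using (_≈_; _∙_; ε)
    open import Relation.Binary.Reasoning.Setoid M.setoid

  record Unit : Set (c ⊔ ℓ) where
    constructor unit
    field
      value      : M.Carrier
      invertible : Invertible _≈_ ε _∙_ value

    inverse : M.Carrier
    inverse = proj₁ invertible

    inverseˡ : inverse ∙ value ≈ ε
    inverseˡ = proj₁ (proj₂ invertible)

    inverseʳ : value ∙ inverse ≈ ε
    inverseʳ = proj₂ (proj₂ invertible)

  open Unit

  private
    cancel-middle : ∀ {w x y z} → x ∙ y ≈ ε → w ∙ z ≈ ε → (w ∙ x) ∙ (y ∙ z) ≈ ε
    cancel-middle {w} {x} {y} {z} xy≈ε wz≈ε = begin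
      (w ∙ x) ∙ (y ∙ z)  ≈⟨ M.assoc w x (y ∙ z) ⟩
      w ∙ (x ∙ (y ∙ z))  ≈⟨ M.∙-congˡ (M.assoc x y z) ⟨
      w ∙ ((x ∙ y) ∙ z)  ≈⟨ M.∙-congˡ (M.∙-congʳ xy≈ε) ⟩
      w ∙ (ε ∙ z)        ≈⟨ M.∙-congˡ (M.identityˡ z) ⟩
      w ∙ z              ≈⟨ wz≈ε ⟩
      ε                  ∎

    inverse-cong : ∀ (u v : Unit) → value u ≈ value v → inverse u ≈ inverse v
    inverse-cong u v u≈v = begin
      inverse u                            ≈⟨ M.identityʳ _ ⟨
      inverse u ∙ ε                        ≈⟨ M.∙-congˡ (inverseʳ v) ⟨
      inverse u ∙ (value v ∙ inverse v)    ≈⟨ M.∙-congˡ (M.∙-congʳ u≈v) ⟨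
      inverse u ∙ (value u ∙ inverse v)    ≈⟨ M.assoc _ _ _ ⟨
      (inverse u ∙ value u) ∙ inverse v    ≈⟨ M.∙-congʳ (inverseˡ u) ⟩
      ε ∙ inverse v                        ≈⟨ M.identityˡ _ ⟩
      inverse v                            ∎

  -- Units are compared by value only; inverses are unique, so the chosen
  -- inverse carries no extra information.
  unitGroup : Group (c ⊔ ℓ) ℓ
  unitGroup = record
    { Carrier = Unit
    ; _≈_     = λ u v → value u ≈ value v
    ; _∙_     = λ u v → unit (value u ∙ value v)
                  ( inverse v ∙ inverse u
                  , cancel-middle (inverseˡ u) (inverseˡ v)
                  , cancel-middle (inverseʳ v) (inverseʳ u) )
    ; ε       = unit ε (ε , M.identityˡ ε , M.identityˡ ε)
    ; _⁻¹     = λ u → unit (inverse u) (value u , inverseʳ u , inverseˡ u)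
    ; isGroup = record
      { isMonoid = record
        { isSemigroup = record
          { isMagma = record
            { isEquivalence = record
              { refl  = M.refl
              ; sym   = M.sym
              ; trans = M.trans
              }
            ; ∙-cong = M.∙-cong
            }
          ; assoc = λ u v w → M.assoc (value u) (value v) (value w)
          }
        ; identity = (λ u → M.identityˡ (value u)) , (λ u → M.identityʳ (value u))
        }
      ; inverse = inverseˡ , inverseʳ
      ; ⁻¹-cong = λ {u} {v} → inverse-cong u v
      }
    }

module _ (G : Group c ℓ) where
  open Group G
  open RawMonoidDefinitions rawMonoid using (_×_)

  -- The library's n × g is the n-fold product of g, written additively.
  power : Carrier → ℤ → Carrier
  power g (+ k)    = k × g
  power g -[1+ k ] = (suc k × g) ⁻¹

  cyclicSubgroup : Carrier → Pred Carrier ℓ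
  cyclicSubgroup g x = ∃[ k ] x ≈ power g k

module _ (n : ℕ) .{{_ : NonZero n}} where

  infixl 7 _*ₙ_

  _*ₙ_ : Fin n → Fin n → Fin n
  i *ₙ j = (toℕ i * toℕ j) mod n

  private
    toℕ-mod : ∀ m → toℕ (m mod n) ≡ m % n
    toℕ-mod m = toℕ-fromℕ< (m%n<n m n)

    mod-cong : ∀ {k m} → k % n ≡ m % n → k mod n ≡ m mod n
    mod-cong {k} {m} eq = toℕ-injective (trans (toℕ-mod k) (trans eq (sym (toℕ-mod m))))

    toℕ-mod-self : ∀ (i : Fin n) → toℕ i mod n ≡ i
    toℕ-mod-self i = toℕ-injective (trans (toℕ-mod (toℕ i)) (m<n⇒m%n≡m (toℕ<n i)))

    mod-*ˡ : ∀ k m → (toℕ (k mod n) * m) mod n ≡ (k * m) mod n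
    mod-*ˡ k m = mod-cong (begin
      (toℕ (k mod n) * m) % n      ≡⟨ cong (λ h → (h * m) % n) (toℕ-mod k) ⟩
      ((k % n) * m) % n            ≡⟨ %-distribˡ-* (k % n) m n ⟩
      ((k % n % n) * (m % n)) % n  ≡⟨ cong (λ h → (h * (m % n)) % n) (m%n%n≡m%n k n) ⟩
      ((k % n) * (m % n)) % n      ≡⟨ %-distribˡ-* k m n ⟨
      (k * m) % n                  ∎)
      where open ≡-Reasoning

    *ₙ-comm : ∀ i j → i *ₙ j ≡ j *ₙ i
    *ₙ-comm i j = cong (_mod n) (*-comm (toℕ i) (toℕ j))

    *ₙ-assoc : ∀ i j k → (i *ₙ j) *ₙ k ≡ i *ₙ (j *ₙ k)
    *ₙ-assoc i j k = begin
      (i *ₙ j) *ₙ k                      ≡⟨ mod-*ˡ (toℕ i * toℕ j) (toℕ k) ⟩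
      (toℕ i * toℕ j * toℕ k) mod n      ≡⟨ cong (_mod n) (*-assoc (toℕ i) (toℕ j) (toℕ k)) ⟩
      (toℕ i * (toℕ j * toℕ k)) mod n    ≡⟨ cong (_mod n) (*-comm (toℕ i) (toℕ j * toℕ k)) ⟩
      (toℕ j * toℕ k * toℕ i) mod n      ≡⟨ mod-*ˡ (toℕ j * toℕ k) (toℕ i) ⟨
      (j *ₙ k) *ₙ i                      ≡⟨ *ₙ-comm (j *ₙ k) i ⟩
      i *ₙ (j *ₙ k)                      ∎
      where open ≡-Reasoning

    *ₙ-identityˡ : ∀ i → (1 mod n) *ₙ i ≡ i
    *ₙ-identityˡ i = trans (mod-*ˡ 1 (toℕ i))
      (trans (cong (_mod n) (*-identityˡ (toℕ i))) (toℕ-mod-self i))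

    *ₙ-identityʳ : ∀ i → i *ₙ (1 mod n) ≡ i
    *ₙ-identityʳ i = trans (*ₙ-comm i (1 mod n)) (*ₙ-identityˡ i)

  -- The identity is 1 mod n rather than 1, so that n = 1 is covered.
  *ₙ-monoid : Monoid 0ℓ 0ℓ
  *ₙ-monoid = record
    { Carrier  = Fin n
    ; _≈_      = _≡_
    ; _∙_      = _*ₙ_
    ; ε        = 1 mod n
    ; isMonoid = record
      { isSemigroup = record
        { isMagma = record { isEquivalence = isEquivalence ; ∙-cong = cong₂ _*ₙ_ }
        ; assoc   = *ₙ-assoc
        }
      ; identity = *ₙ-identityˡ , *ₙ-identityʳ
      }
    }

  ℤ* : Group 0ℓ 0ℓ
  ℤ* = unitGroup *ₙ-monoid

ℤ₂^ : ℕ → AbelianGroup 0ℓ 0ℓ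
ℤ₂^ n = pointwiseAbelianGroup (Fin n) Sign.*-abelianGroup

module _ {n : ℕ} .{{_ : NonZero n}} where

  ⟨_⟩ : Group.Carrier (ℤ* n) → Pred (Group.Carrier (ℤ* n)) 0ℓ
  ⟨_⟩ = cyclicSubgroup (ℤ* n)

  δ : Group.Carrier (ℤ* n) → AbelianGroup.Carrier (ℤ₂^ n) → AbelianGroup.Carrier (ℤ₂^ n)
  δ a Y i = Y ((toℕ (Unit.value a) * toℕ i) mod n)

𝕀 : (n : ℕ) .{{_ : NonZero n}} → Group.Carrier (ℤ* n) → Pred (AbelianGroup.Carrier (ℤ₂^ n)) 0ℓ
𝕀 n a Y = δ a Y ≈ Y
  where open AbelianGroup (ℤ₂^ n) using (_≈_)

{-# OPTIONS --safe #-}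

-- The units u with Y (u i) = Y i for all i form a subgroup of ℤ* n; if it
-- contains a it contains ⟨ a ⟩, hence b.
module Submission where

open import Defs
open import Algebra.Bundles using (Monoid; Group; AbelianGroup)
import Algebra.Definitions.RawMonoid as RawMonoidDefinitions
open import Data.Integer.Base using (+_; -[1+_])
open import Data.Nat.Base using (ℕ; zero; suc; NonZero)
open import Data.Product.Base using (_,_)
open import Level using (Level; _⊔_)
open import Relation.Binary.Definitions using (_Respects_)
open import Relation.Binary.PropositionalEquality using (sym; trans; cong)
open import Relation.Unary using (Pred; _∈_; _⊆_)

-- Decimations define an action of the units on sequences, so the units fixing a given `Y` form a
-- subgroup, its stabilizer. If `a` lies in it, so does all of `⟨ a ⟩`, the least subgroup
-- containing `a`; by hypothesis this includes `b`.

private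
  variable
    c ℓ p : Level

module _ (G : Group c ℓ) where
  open Group G hiding (sym; trans)
  open RawMonoidDefinitions rawMonoid using (_×_)

  generator∈cyclicSubgroup : ∀ g → g ∈ cyclicSubgroup G g
  -- `1 × g` unfolds to `g ∙ ε`.
  generator∈cyclicSubgroup g = + 1 , Group.sym G (identityʳ g)

  -- `resp` is required because elements of a cyclic subgroup equal powers only up to `≈`.
  record IsSubgroup (P : Pred Carrier p) : Set (c ⊔ ℓ ⊔ p) where
    field
      resp      : P Respects _≈_
      ε-closed  : P ε
      ∙-closed  : ∀ {x y} → P x → P y → P (x ∙ y)
      ⁻¹-closed : ∀ {x} → P x → P (x ⁻¹)

  module _ {P : Pred Carrier p} (isSubgroup : IsSubgroup P) where
    open IsSubgroup isSubgroup

    ×-closed : ∀ {g} → P g → ∀ k → P (k × g)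
    ×-closed Pg zero    = ε-closed
    ×-closed Pg (suc k) = ∙-closed Pg (×-closed Pg k)

    power-closed : ∀ {g} → P g → ∀ k → P (power G g k)
    power-closed Pg (+ k)    = ×-closed Pg k
    power-closed Pg -[1+ k ] = ⁻¹-closed (×-closed Pg (suc k))

    cyclicSubgroup-least : ∀ {g} → P g → cyclicSubgroup G g ⊆ P
    cyclicSubgroup-least Pg (k , x≈gᵏ) = resp (Group.sym G x≈gᵏ) (power-closed Pg k)

module _ (n : ℕ) .{{_ : NonZero n}} where
  open Group (ℤ* n) using (Carrier)
  open Monoid (*ₙ-monoid n) using (assoc; identityˡ)

  Stabilizer : AbelianGroup.Carrier (ℤ₂^ n) → Pred Carrier _
  Stabilizer Y u = Y ∈ 𝕀 n u

  stabilizer-isSubgroup : ∀ Y → IsSubgroup (ℤ* n) (Stabilizer Y)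
  stabilizer-isSubgroup Y = record
    { resp      = λ u≡v fix i → trans (cong (λ w → Y (_*ₙ_ n w i)) (sym u≡v)) (fix i)
    ; ε-closed  = λ i → cong Y (identityˡ i)
    -- `Y((uv)i) = Y(u(vi)) = Y(vi) = Y(i)`, with `fixᵤ` taken at the index `vi`.
    ; ∙-closed  = λ {u} {v} fixᵤ fixᵥ i →
        trans (cong Y (assoc (value u) (value v) i)) (trans (fixᵤ _) (fixᵥ i))
    -- Taking `fix` at the index `u⁻¹i` gives `Y(u⁻¹i) = Y(u(u⁻¹i)) = Y(i)`.
    ; ⁻¹-closed = λ {u} fix i → trans (sym (fix _)) (cong Y
        (trans (sym (assoc (value u) (inverse u) i))
          (trans (cong (λ w → _*ₙ_ n w i) (inverseʳ u)) (identityˡ i))))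
    }
    where open Unit

theorem1 : (n : ℕ) .{{_ : NonZero n}} (a b : Group.Carrier (ℤ* n)) →
    ⟨ b ⟩ ⊆ ⟨ a ⟩ → 𝕀 n a ⊆ 𝕀 n b
theorem1 n a b ⟨b⟩⊆⟨a⟩ {Y} Y∈𝕀a =
  cyclicSubgroup-least (ℤ* n) (stabilizer-isSubgroup n Y) {a} Y∈𝕀a {b}
    (⟨b⟩⊆⟨a⟩ {b} (generator∈cyclicSubgroup (ℤ* n) b))
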